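{- For every fixed integer $r\geq 3$, we have $M^r_{r+1}(n)=\Theta(n^r)$, where $M^r_{r+1}(n)$ denotes the maximum running time of the $K^{(r)}_{r+1}$-bootstrap percolation process over all $r$-uniform hypergraphs $G_0$ on vertex set $[n]$ (the implicit constants depending only on $r$).
   Context: For an $r$-uniform hypergraph $H$ and an $r$-uniform hypergraph $G_0$ on vertex set $[n]=\{1,\dots,n\}$, the $H$-bootstrap percolation process is defined as follows: for each $t\geq 1$, $G_t$ is the $r$-uniform hypergraph on $[n]$ whose edge set consists of $E(G_{t-1})$ together with every $e\in\binom{[n]}{r}$ for which there exists a copy $H'$ of $H$ in $K^{(r)}_n$ with $E(H')\not\subseteq E(G_{t-1})$ and $E(H')\subseteq E(G_{t-1})\cup\{e\}$. The running time of the process on $G_0$ is $M_H(G_0)=\min\{t: G_t=G_{t+1}\}$, and $M_H(n)$ is the maximum of $M_H(G_0)$ over all $r$-uniform hypergraphs $G_0$ on $n$ vertices. $K^{(r)}_{k}$ denotes the complete $r$-uniform hypergraph on $k$ vertices, and $M^r_k(n)=M_{K^{(r)}_k}(n)$. -}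

module Defs where

open import Data.Nat using (ℕ; zero; suc; _<_)
open import Data.Fin.Subset using (Subset; _⊆_; ∣_∣)
open import Data.Product using (Σ; _×_; ∃)
open import Data.Sum using (_⊎_)
open import Relation.Nullary using (¬_)
open import Relation.Binary.PropositionalEquality using (_≡_)

Hypergraph : ℕ → Set₁
Hypergraph n = Subset n → Set

Uniform : {n : ℕ} → ℕ → Hypergraph n → Set
Uniform r G = ∀ e → G e → ∣ e ∣ ≡ r

-- A copy H' of K^(r)_k in K^(r)_n is determined by its k-element vertex set S;
-- its edges are exactly the r-subsets of S.
CopyEdges : {n : ℕ} → ℕ → Subset n → Subset n → Set
CopyEdges r S f = f ⊆ S × ∣ f ∣ ≡ r

step : {n : ℕ} → (r k : ℕ) → Hypergraph n → Hypergraph n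
step r k G e =
  G e ⊎
  (∣ e ∣ ≡ r ×
    ∃ λ S → ∣ S ∣ ≡ k
      × ¬ (∀ f → CopyEdges r S f → G f)
      × (∀ f → CopyEdges r S f → G f ⊎ f ≡ e))

process : {n : ℕ} → (r k : ℕ) → Hypergraph n → ℕ → Hypergraph n
process r k G₀ zero = G₀
process r k G₀ (suc t) = step r k (process r k G₀ t)

SameEdges : {n : ℕ} → Hypergraph n → Hypergraph n → Set
SameEdges G H = ∀ e → (G e → H e) × (H e → G e)

IsRunningTime : {n : ℕ} → (r k : ℕ) → Hypergraph n → ℕ → Set
IsRunningTime r k G₀ t =
  SameEdges (process r k G₀ t) (process r k G₀ (suc t))
  × (∀ s → s < t → ¬ SameEdges (process r k G₀ s) (process r k G₀ (suc s)))

{-# OPTIONS --safe #-}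
-- Upper bound: every step before stabilisation infects a new r-set, and there are at most n ^ r of them.
--
-- Lower bound: let the final hypergraph consist of all r-cliques of an r-partite graph. For r ≥ 3 an
-- (r+1)-set containing a non-adjacent pair lacks at least two of its r-subsets, so only (r+1)-cliques
-- spread the infection; one that contains a transversal r-clique contains exactly two, which differ in
-- a single part. If these moves arrange the transversal cliques into a path and all other r-cliques are
-- infected initially together with one end of the path, then the path is infected one edge at a time.
-- Graphs with long paths are built like an odometer. Given one for r, take three copies of it and a path
-- x₀, …, x_{K-1} of vertices in a new part; join x_k to copy k mod 3 and to the last clique of the
-- preceding copy. Cross edges let the digits of that last clique be exchanged one by one, slowest digit
-- first, for those of the first clique of the next copy. This turns n vertices and length T into K + 3 n
-- vertices and length at least K T, so by induction on r the length is of order n ^ r.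
module Submission where

open import Defs
open import Data.Nat using (ℕ; zero; suc; _+_; _∸_; _*_; _^_; _≤_; _<_; z≤n; s≤s; s≤s⁻¹; _≤′_; ≤′-refl; ≤′-step)
open import Data.Nat.DivMod using (_/_; _%_; m/n*n≤m; m≡m%n+[m/n]*n; m%n<n; /-monoˡ-≤; m*n/n≡m)
import Data.Nat.Properties as ℕ
open import Data.Nat.Tactic.RingSolver using (solve-∀)
open import Data.Bool.Properties using () renaming (_≟_ to _≟ᵇ_)
open import Data.Fin using (Fin; zero; suc; toℕ; fromℕ; fromℕ<; inject₁; funToFin; finToFun; _≟_; _<?_)
import Data.Fin as Fin
open import Data.Fin.Patterns using (0F; 1F; 2F)
import Data.Fin.Properties as Fin
open import Data.Fin.Subset using (Subset; inside; outside; ⊥; ⁅_⁆; _∪_; _-_; _∈_; _∉_; _⊆_; ∣_∣; Nonempty)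
open import Data.Fin.Subset.Properties
open import Data.Product using (Σ; ∃; _×_; _,_; proj₁; proj₂)
import Data.Product as Product
open import Data.Sum using (_⊎_; inj₁; inj₂; swap)
import Data.Sum as Sum
open import Data.Sum.Function.Propositional using (_⊎-↔_)
open import Data.Sum.Properties using (inj₁-injective; inj₂-injective)
open import Data.Vec using ([]; _∷_; here; there)
open import Data.Vec.Functional using (updateAt)
open import Data.Vec.Functional.Properties using (updateAt-updates; updateAt-minimal)
open import Data.Vec.Properties using (≡-dec)
open import Effect.Monad using (RawMonad)
open import Function using (_∘_; const; Injective; Inverse; _↔_)
open import Function.Properties.Inverse using (↔-refl; ↔-sym; ↔-trans)
open import Relation.Binary.Definitions using (tri<; tri≈; tri>)
open import Relation.Binary.PropositionalEquality
  using (_≡_; _≢_; refl; sym; trans; cong; cong₂; subst; subst₂; ≢-sym; module ≡-Reasoning)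
open import Relation.Nullary using (¬_; Dec; yes; no; contradiction; ¬?; _×-dec_)
open import Relation.Nullary.Decidable using (decidable-stable)
open import Relation.Nullary.Negation using (¬¬-Monad)

private variable
  m n r k : ℕ
  V W : Set

-- Subsets of Fin n

⊆∧∣∣≤⇒≡ : {p q : Subset n} → p ⊆ q → ∣ q ∣ ≤ ∣ p ∣ → p ≡ q
⊆∧∣∣≤⇒≡ {p = p} {q} p⊆q ∣q∣≤∣p∣ = ⊆-antisym p⊆q q⊆p
  where
  q⊆p : q ⊆ p
  q⊆p {x} x∈q with x ∈? p
  ... | yes x∈p = x∈p
  ... | no x∉p = contradiction ∣q∣≤∣p∣ (ℕ.<⇒≱ (p⊂q⇒∣p∣<∣q∣ (p⊆q , x , x∈q , x∉p)))

∣⁅x⁆∪p∣≡1+∣p∣ : {x : Fin n} (p : Subset n) → x ∉ p → ∣ ⁅ x ⁆ ∪ p ∣ ≡ suc ∣ p ∣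
∣⁅x⁆∪p∣≡1+∣p∣ {x = zero} (inside ∷ p) x∉p = contradiction here x∉p
∣⁅x⁆∪p∣≡1+∣p∣ {x = zero} (outside ∷ p) _ = cong (suc ∘ ∣_∣) (∪-identityˡ p)
∣⁅x⁆∪p∣≡1+∣p∣ {x = suc x} (inside ∷ p) x∉p = cong suc (∣⁅x⁆∪p∣≡1+∣p∣ p (x∉p ∘ there))
∣⁅x⁆∪p∣≡1+∣p∣ {x = suc x} (outside ∷ p) x∉p = ∣⁅x⁆∪p∣≡1+∣p∣ p (x∉p ∘ there)

image : (Fin m → Fin n) → Subset n
image {zero} t = ⊥
image {suc m} t = ⁅ t zero ⁆ ∪ image (t ∘ suc)

∈-image⁺ : (t : Fin m → Fin n) (i : Fin m) → t i ∈ image t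
∈-image⁺ t zero = x∈p∪q⁺ (inj₁ (x∈⁅x⁆ (t zero)))
∈-image⁺ t (suc i) = x∈p∪q⁺ (inj₂ (∈-image⁺ (t ∘ suc) i))

∈-image⁻ : (t : Fin m → Fin n) {x : Fin n} → x ∈ image t → ∃ λ i → x ≡ t i
∈-image⁻ {zero} t x∈ = contradiction x∈ ∉⊥
∈-image⁻ {suc m} t x∈ with x∈p∪q⁻ ⁅ t zero ⁆ (image (t ∘ suc)) x∈
... | inj₁ x∈⁅⁆ = zero , x∈⁅y⁆⇒x≡y (t zero) x∈⁅⁆
... | inj₂ x∈im with i , x≡ ← ∈-image⁻ (t ∘ suc) x∈im = suc i , x≡

∣image∣ : (t : Fin m → Fin n) → Injective _≡_ _≡_ t → ∣ image t ∣ ≡ m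
∣image∣ {zero} {n} t inj = ∣⊥∣≡0 n
∣image∣ {suc m} t inj =
  trans (∣⁅x⁆∪p∣≡1+∣p∣ (image (t ∘ suc)) t₀∉)
        (cong suc (∣image∣ (t ∘ suc) (Fin.suc-injective ∘ inj)))
  where
  t₀∉ : t zero ∉ image (t ∘ suc)
  t₀∉ t₀∈ with i , eq ← ∈-image⁻ (t ∘ suc) t₀∈ with () ← inj eq

image-cong : {t u : Fin m → Fin n} → (∀ i → t i ≡ u i) → image t ≡ image u
image-cong {zero} t≗u = refl
image-cong {suc m} t≗u = cong₂ (λ x p → ⁅ x ⁆ ∪ p) (t≗u zero) (image-cong (t≗u ∘ suc))

image-suc : (t : Fin m → Fin n) → image (suc ∘ t) ≡ outside ∷ image t
image-suc {zero} t = refl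
image-suc {suc m} t = cong (⁅ suc (t zero) ⁆ ∪_) (image-suc (t ∘ suc))

-- Lists the elements of a set, so that r-sets can be coded by r-tuples and hence by numbers below
-- `n ^ r`.
image-surjective : (p : Subset n) → ∃ λ (t : Fin ∣ p ∣ → Fin n) → image t ≡ p
image-surjective [] = (λ ()) , refl
image-surjective (outside ∷ p) with t , eq ← image-surjective p =
  suc ∘ t , trans (image-suc t) (cong (outside ∷_) eq)
image-surjective (inside ∷ p) with t , eq ← image-surjective p =
  (λ { zero → zero ; (suc i) → suc (t i) }) ,
  trans (cong (⁅ zero ⁆ ∪_) (image-suc t)) (cong (inside ∷_) (trans (∪-identityˡ _) eq))

x∉p-x : (x : Fin n) (p : Subset n) → x ∉ p - x
x∉p-x zero (_ ∷ p) ()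
x∉p-x (suc x) (_ ∷ p) (there x∈) = x∉p-x x p x∈

∣p∣≤1+∣p-x∣ : (p : Subset n) (x : Fin n) → ∣ p ∣ ≤ suc ∣ p - x ∣
∣p∣≤1+∣p-x∣ p x = subst (∣ p ∣ ≤_) (∣⁅x⁆∪p∣≡1+∣p∣ (p - x) (x∉p-x x p)) (p⊆q⇒∣p∣≤∣q∣ p⊆)
  where
  p⊆ : p ⊆ ⁅ x ⁆ ∪ (p - x)
  p⊆ {y} y∈p with y ≟ x
  ... | yes refl = x∈p∪q⁺ (inj₁ (x∈⁅x⁆ x))
  ... | no y≢x = x∈p∪q⁺ (inj₂ (x∈p∧x≢y⇒x∈p-y y∈p y≢x))

x∈p⇒∣p∣≡1+∣p-x∣ : {p : Subset n} {x : Fin n} → x ∈ p → ∣ p ∣ ≡ suc ∣ p - x ∣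
x∈p⇒∣p∣≡1+∣p-x∣ {p = p} {x} x∈p = ℕ.≤-antisym (∣p∣≤1+∣p-x∣ p x) (x∈p⇒∣p-x∣<∣p∣ x∈p)

∣p∣<∣q∣⇒q⊈p : {p q : Subset n} → ∣ p ∣ < ∣ q ∣ → ∃ λ x → x ∈ q × x ∉ p
∣p∣<∣q∣⇒q⊈p {p = p} {q} ∣p∣<∣q∣ with Fin.any? (λ x → (x ∈? q) ×-dec ¬? (x ∈? p))
... | yes found = found
... | no ¬found = contradiction (p⊆q⇒∣p∣≤∣q∣ q⊆p) (ℕ.<⇒≱ ∣p∣<∣q∣)
  where
  q⊆p : q ⊆ p
  q⊆p {x} x∈q = decidable-stable (x ∈? p) λ x∉p → ¬found (x , x∈q , x∉p)

∈-remove : {p : Subset n} {x y : Fin n} → x ∈ p - y → x ∈ p × x ≢ y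
∈-remove {p = p} {x} {y} x∈ = p─q⊆p p ⁅ y ⁆ x∈ , λ { refl → x∉p-x x p x∈ }

m<∣p∣⇒m≤∣p-x∣ : (p : Subset n) (x : Fin n) → m < ∣ p ∣ → m ≤ ∣ p - x ∣
m<∣p∣⇒m≤∣p-x∣ p x 1+m≤ = s≤s⁻¹ (ℕ.≤-trans 1+m≤ (∣p∣≤1+∣p-x∣ p x))

0<∣p∣⇒Nonempty : {p : Subset n} → 0 < ∣ p ∣ → Nonempty p
0<∣p∣⇒Nonempty {n} {p} 0<∣p∣ =
  let x , x∈p , _ = ∣p∣<∣q∣⇒q⊈p {p = ⊥} (subst (_< ∣ p ∣) (sym (∣⊥∣≡0 n)) 0<∣p∣) in x , x∈p

-- Two distinct elements w, z of S other than u and v exist, and S - w, S - z cannot both be e.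
avoiding-subset : {S : Subset n} → ∣ S ∣ ≡ suc r → 3 ≤ r → ∀ {u v} → u ∈ S → v ∈ S → (e : Subset n) →
  ∃ λ f → f ⊆ S × ∣ f ∣ ≡ r × u ∈ f × v ∈ f × f ≢ e
avoiding-subset {n} {r} {S} ∣S∣ 3≤r {u} {v} u∈S v∈S e
  = let w , w∈ = 0<∣p∣⇒Nonempty (ℕ.<-trans (s≤s z≤n) 2≤)
        z , z∈ = 0<∣p∣⇒Nonempty (m<∣p∣⇒m≤∣p-x∣ (S - u - v) w 2≤)
    in result w∈ z∈
  where
  2≤ : 2 ≤ ∣ S - u - v ∣
  2≤ = m<∣p∣⇒m≤∣p-x∣ (S - u) v (m<∣p∣⇒m≤∣p-x∣ S u (subst (4 ≤_) (sym ∣S∣) (s≤s 3≤r)))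

  without : ∀ {x} → x ∈ S - u - v → S - x ≢ e → ∃ λ f → f ⊆ S × ∣ f ∣ ≡ r × u ∈ f × v ∈ f × f ≢ e
  without {x} x∈ ≢e =
    let x∈S-u , x≢v = ∈-remove x∈
        x∈S , x≢u = ∈-remove x∈S-u
    in S - x , p─q⊆p S ⁅ x ⁆ , ℕ.suc-injective (trans (sym (x∈p⇒∣p∣≡1+∣p-x∣ x∈S)) ∣S∣)
     , x∈p∧x≢y⇒x∈p-y u∈S (≢-sym x≢u) , x∈p∧x≢y⇒x∈p-y v∈S (≢-sym x≢v) , ≢e

  result : ∀ {w z} → w ∈ S - u - v → z ∈ S - u - v - w →
    ∃ λ f → f ⊆ S × ∣ f ∣ ≡ r × u ∈ f × v ∈ f × f ≢ e
  result {w} {z} w∈ z∈ with ≡-dec _≟ᵇ_ (S - w) e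
  ... | no ≢e = without w∈ ≢e
  ... | yes refl =
    let z∈Suv , z≢w = ∈-remove z∈
        z∈Su , _ = ∈-remove z∈Suv
        z∈S , _ = ∈-remove z∈Su
    in without z∈Suv λ eq → x∉p-x z S (subst (z ∈_) (sym eq) (x∈p∧x≢y⇒x∈p-y z∈S z≢w))

-- Counting the steps of the process

-- Double negation commutes with a quantifier over a finite type; the induction splits on the first
-- bit of the subset.
¬¬-∀-Subset : {P : Subset n → Set} → (∀ p → ¬ ¬ P p) → ¬ ¬ (∀ p → P p)
¬¬-∀-Subset {zero} ¬¬P ¬∀P = ¬¬P [] λ P[] → ¬∀P λ { [] → P[] }
¬¬-∀-Subset {suc n} ¬¬P ¬∀P =
  ¬¬-∀-Subset (¬¬P ∘ (outside ∷_)) λ Pout →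
  ¬¬-∀-Subset (¬¬P ∘ (inside ∷_)) λ Pin →
  ¬∀P λ { (outside ∷ p) → Pout p ; (inside ∷ p) → Pin p }

step-cong : {G H : Hypergraph n} → SameEdges G H → ∀ {e} → step r k G e → step r k H e
step-cong same {e} (inj₁ Ge) = inj₁ (proj₁ (same e) Ge)
step-cong same (inj₂ (∣e∣ , S , ∣S∣ , ¬all , cov)) = inj₂ (∣e∣ , S , ∣S∣ ,
  (λ all → ¬all λ f f∈ → proj₂ (same f) (all f f∈)) ,
  λ f f∈ → Sum.map₁ (proj₁ (same f)) (cov f f∈))

process-mono : {G₀ : Hypergraph n} {s t : ℕ} → s ≤ t →
  ∀ {e} → process r k G₀ s e → process r k G₀ t e
process-mono {r = r} {k} {G₀} s≤t = go (ℕ.≤⇒≤′ s≤t)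
  where
  go : ∀ {s t} → s ≤′ t → ∀ {e} → process r k G₀ s e → process r k G₀ t e
  go ≤′-refl Ge = Ge
  go (≤′-step s≤t) Ge = inj₁ (go s≤t Ge)

process-uniform : {G₀ : Hypergraph n} → Uniform r G₀ → ∀ t → Uniform r (process r k G₀ t)
process-uniform unif zero e Ge = unif e Ge
process-uniform unif (suc t) e (inj₁ Ge) = process-uniform unif t e Ge
process-uniform unif (suc t) e (inj₂ (∣e∣ , _)) = ∣e∣

-- Membership in a hypergraph need not be decidable, so new edges are only available up to double negation.
runningTime≤nʳ : (G₀ : Hypergraph n) → Uniform r G₀ → ∀ t → IsRunningTime r k G₀ t → t ≤ n ^ r
runningTime≤nʳ {n} {r} {k} G₀ unif t (_ , unstable) = decidable-stable (t ℕ.≤? n ^ r) λ t≰ →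
  -- The goal is now absurdity, so new edges may be chosen for all `t` steps at once under double
  -- negation; coding them embeds `Fin t` into `Fin (n ^ r)`.
  Fin.sequence (RawMonad.rawApplicative ¬¬-Monad) newEdge λ e → t≰ (Fin.injective⇒≤ {f = code e} (code-injective e))
  where
  G : ℕ → Hypergraph n
  G = process r k G₀

  New : Fin t → Set
  New s = ∃ λ e → G (suc (toℕ s)) e × ¬ G (toℕ s) e

  newEdge : ∀ s → ¬ ¬ New s
  newEdge s ¬new = ¬¬-∀-Subset {P = λ e → G (suc (toℕ s)) e → G (toℕ s) e}
    (λ e ¬imp → ¬imp λ G′e → contradiction (e , G′e , λ Ge → ¬imp λ _ → Ge) ¬new)
    λ back → unstable (toℕ s) (Fin.toℕ<n s) λ e → inj₁ , back e

  module _ (e : ∀ s → New s) where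
    enum : ∀ s → ∃ λ (f : Fin r → Fin n) → image f ≡ proj₁ (e s)
    enum s with es , G′e , _ ← e s with refl ← process-uniform unif (suc (toℕ s)) es G′e = image-surjective es

    elements : Fin t → Fin r → Fin n
    elements s = proj₁ (enum s)

    code : Fin t → Fin (n ^ r)
    code s = funToFin (elements s)

    -- The edge that is new at `s` already lies in `G (toℕ s′)` by monotonicity, while the one
    -- chosen for `s′` does not.
    distinct : ∀ {s s′} → toℕ s < toℕ s′ → ¬ proj₁ (e s) ≡ proj₁ (e s′)
    distinct {s} {s′} s<s′ eq = proj₂ (proj₂ (e s′))
      (subst (G (toℕ s′)) eq (process-mono s<s′ (proj₁ (proj₂ (e s)))))

    code-reflects : ∀ {s s′} → code s ≡ code s′ → proj₁ (e s) ≡ proj₁ (e s′)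
    code-reflects {s} {s′} eq = begin
      proj₁ (e s)           ≡⟨ proj₂ (enum s) ⟨
      image (elements s)    ≡⟨ image-cong same ⟩
      image (elements s′)   ≡⟨ proj₂ (enum s′) ⟩
      proj₁ (e s′)          ∎
      where
      open ≡-Reasoning
      same : ∀ i → elements s i ≡ elements s′ i
      same i = begin
        elements s i            ≡⟨ Fin.finToFun-funToFin (elements s) i ⟨
        finToFun (code s) i     ≡⟨ cong (λ c → finToFun c i) eq ⟩
        finToFun (code s′) i    ≡⟨ Fin.finToFun-funToFin (elements s′) i ⟩
        elements s′ i           ∎

    code-injective : Injective _≡_ _≡_ code
    code-injective {s} {s′} eq with ℕ.<-cmp (toℕ s) (toℕ s′)
    ... | tri≈ _ s≡s′ _ = Fin.toℕ-injective s≡s′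
    ... | tri< s<s′ _ _ = contradiction (code-reflects eq) (distinct s<s′)
    ... | tri> _ _ s>s′ = contradiction (code-reflects (sym eq)) (distinct s>s′)

-- Percolation along a path of transversal cliques

record IsTransversal (part : V → Fin r) (Adj : V → V → Set) (τ : Fin r → V) : Set where
  field
    parts : ∀ i → part (τ i) ≡ i
    adjacent : ∀ {i j} → i ≢ j → Adj (τ i) (τ j)

-- Adjacency of the two values of the digit makes the union of two such transversal cliques an
-- (r+1)-clique, through which the infection can pass.
record Move (Adj : V → V → Set) (σ τ : Fin r → V) : Set where
  field
    digit : Fin r
    adjacent : Adj (σ digit) (τ digit)
    same : ∀ {i} → i ≢ digit → σ i ≡ τ i

-- An r-partite graph whose transversal r-cliques, joined when they differ in one digit by an edge
-- of the graph, form a path of length T.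
record CliquePath (r T : ℕ) (V : Set) : Set₁ where
  field
    part : V → Fin r
    Adj : V → V → Set
    adj-sym : ∀ {u v} → Adj u v → Adj v u
    State : Set
    tuple : State → Fin r → V
    rank : State → ℕ
    first last : State
    rank-first : rank first ≡ 0
    rank-last : rank last ≡ T
    rank≤T : ∀ s → rank s ≤ T
    transversal : ∀ s → IsTransversal part Adj (tuple s)
    tuple-injective : ∀ {s s′} → (∀ i → tuple s i ≡ tuple s′ i) → s ≡ s′
    complete : ∀ {τ} → IsTransversal part Adj τ → ∃ λ s → ∀ i → τ i ≡ tuple s i
    -- Together, `rigid` and `pred` say that `rank` is the distance from `first` in the graph of
    -- moves.
    rigid : ∀ {s s′} → Move Adj (tuple s) (tuple s′) → rank s′ ≤ suc (rank s)
    pred : ∀ s → s ≡ first ⊎ ∃ λ s′ → rank s ≡ suc (rank s′) × Move Adj (tuple s′) (tuple s)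

  module _ (s : State) where
    open IsTransversal (transversal s) public renaming (parts to tuple-part; adjacent to tuple-adj)

relabel : {T : ℕ} → V ↔ W → CliquePath r T V → CliquePath r T W
relabel φ P = record
  { part = part ∘ from
  ; Adj = λ u v → Adj (from u) (from v)
  ; adj-sym = adj-sym
  ; State = State
  ; tuple = λ s → to ∘ tuple s
  ; rank = rank
  ; first = first
  ; last = last
  ; rank-first = rank-first
  ; rank-last = rank-last
  ; rank≤T = rank≤T
  ; transversal = λ s → record
    { parts = λ i → trans (cong part (strictlyInverseʳ _)) (tuple-part s i)
    ; adjacent = λ i≢j → adj⁺ (tuple-adj s i≢j) }
  ; tuple-injective = λ eq → tuple-injective λ i → to-injective (eq i)
  ; complete = λ τ-trans → Product.map₂ (λ eq i → trans (sym (strictlyInverseˡ _)) (cong to (eq i)))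
      (complete record { IsTransversal τ-trans })
  ; rigid = λ mv → rigid (record
    { digit = Move.digit mv
    ; adjacent = subst₂ Adj (strictlyInverseʳ _) (strictlyInverseʳ _) (Move.adjacent mv)
    ; same = to-injective ∘ Move.same mv })
  ; pred = λ s → Sum.map₂ (λ (s′ , rk , mv) → s′ , rk , record
    { digit = Move.digit mv ; adjacent = adj⁺ (Move.adjacent mv) ; same = cong to ∘ Move.same mv }) (pred s)
  }
  where
  open CliquePath P
  open Inverse φ
  to-injective : ∀ {u v} → to u ≡ to v → u ≡ v
  to-injective eq = trans (sym (strictlyInverseʳ _)) (trans (cong from eq) (strictlyInverseʳ _))
  adj⁺ : ∀ {u v} → Adj u v → Adj (from (to u)) (from (to v))
  adj⁺ = subst₂ Adj (sym (strictlyInverseʳ _)) (sym (strictlyInverseʳ _))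

module Percolation {r n T : ℕ} (3≤r : 3 ≤ r) (P : CliquePath r T (Fin n)) where
  open CliquePath P

  Clique : Subset n → Set
  Clique e = ∀ {u v} → u ∈ e → v ∈ e → u ≢ v → Adj u v

  clique-⊆ : ∀ {e S} → e ⊆ S → Clique S → Clique e
  clique-⊆ e⊆S cl u∈ v∈ = cl (e⊆S u∈) (e⊆S v∈)

  digits-injective : ∀ {τ : Fin r → Fin n} → (∀ i → part (τ i) ≡ i) → ∀ {i j} → τ i ≡ τ j → i ≡ j
  digits-injective parts {i} {j} eq = trans (sym (parts i)) (trans (cong part eq) (parts j))

  transversal-∈ : ∀ {τ S} → (∀ i → part (τ i) ≡ i) → (∀ i → τ i ∈ S) → Clique S → IsTransversal part Adj τ
  transversal-∈ parts τ∈S cl = record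
    { parts = parts
    ; adjacent = λ {i} {j} i≢j → cl (τ∈S i) (τ∈S j) (i≢j ∘ digits-injective parts) }

  edge : State → Subset n
  edge s = image (tuple s)

  ∣edge∣ : ∀ s → ∣ edge s ∣ ≡ r
  ∣edge∣ s = ∣image∣ (tuple s) (digits-injective (tuple-part s))

  edge-⊆ : ∀ {s S} → (∀ i → tuple s i ∈ S) → edge s ⊆ S
  edge-⊆ {s} t∈S x∈ with i , refl ← ∈-image⁻ (tuple s) x∈ = t∈S i

  edge-clique : ∀ s → Clique (edge s)
  edge-clique s u∈ v∈ u≢v with i , refl ← ∈-image⁻ (tuple s) u∈ | j , refl ← ∈-image⁻ (tuple s) v∈ =
    tuple-adj s λ { refl → u≢v refl }

  edge-injective : ∀ {s s′} → edge s ≡ edge s′ → s ≡ s′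
  edge-injective {s} {s′} eq = tuple-injective same
    where
    same : ∀ i → tuple s i ≡ tuple s′ i
    same i with j , t≡ ← ∈-image⁻ (tuple s′) (subst (tuple s i ∈_) eq (∈-image⁺ (tuple s) i))
      = trans t≡ (cong (tuple s′) (trans (sym (tuple-part s′ j)) (trans (cong part (sym t≡)) (tuple-part s i))))

  -- An r-clique is an edge of the path exactly when it meets every part, and this is decidable even
  -- if `Adj` is not.
  isEdge? : ∀ {e} → Clique e → ∣ e ∣ ≡ r → Dec (∃ λ s → e ≡ edge s)
  isEdge? {e} cl ∣e∣ with Fin.all? (λ i → Fin.any? (λ v → (v ∈? e) ×-dec (part v ≟ i)))
  ... | yes h =
    let s , eq = complete (transversal-∈ (proj₂ ∘ proj₂ ∘ h) (proj₁ ∘ proj₂ ∘ h) cl)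
    in yes (s , sym (⊆∧∣∣≤⇒≡ (edge-⊆ {s} λ i → subst (_∈ e) (eq i) (proj₁ (proj₂ (h i))))
                             (ℕ.≤-reflexive (trans ∣e∣ (sym (∣edge∣ s))))))
  ... | no ¬h = no λ { (s , refl) → ¬h λ i → tuple s i , ∈-image⁺ (tuple s) i , tuple-part s i }

  -- Closed form of the process after `t` steps. Cliques off the path satisfy the last condition
  -- vacuously, so they are infected from the start.
  Infected : ℕ → Hypergraph n
  Infected t e = ∣ e ∣ ≡ r × Clique e × (∀ s → e ≡ edge s → rank s ≤ t)

  -- The spreading set `S` is a clique. If `e` is on the path, swapping the vertex `v` of `S`
  -- outside `e` into its part gives a second transversal clique in `S`; it is already infected, and
  -- `rigid` bounds the rank of `e`.
  sound : ∀ {t e} → step r (suc r) (Infected t) e → Infected (suc t) e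
  sound (inj₁ (∣e∣ , cl , rk)) = ∣e∣ , (λ {_} → cl) , λ s eq → ℕ.m≤n⇒m≤1+n (rk s eq)
  sound {t} {e} (inj₂ (∣e∣ , S , ∣S∣ , ¬all , cov)) = ∣e∣ , (λ {_} → clique-⊆ e⊆S clS) , rank≤
    where
    e⊆S : e ⊆ S
    -- Otherwise no r-subset of `S` equals `e`, so all of them would be infected already.
    e⊆S = decidable-stable (e ⊆? S) λ e⊈S → ¬all λ f f∈ → infected e⊈S f f∈
      where
      infected : ¬ (e ⊆ S) → ∀ f → CopyEdges r S f → Infected t f
      infected e⊈S f f∈ with cov f f∈
      ... | inj₁ inf = inf
      ... | inj₂ refl = contradiction {A = e ⊆ S} (proj₁ f∈) e⊈S

    other : ∀ {f} → f ⊆ S → ∣ f ∣ ≡ r → f ≢ e → Infected t f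
    other {f} f⊆S ∣f∣ f≢e with cov f (f⊆S , ∣f∣)
    ... | inj₁ inf = inf
    ... | inj₂ f≡e = contradiction f≡e f≢e

    -- Any two vertices of `S` share an r-subset other than `e`, which is infected and hence a
    -- clique; this rests on `3 ≤ r`.
    clS : Clique S
    clS u∈ v∈ u≢v with f , f⊆S , ∣f∣ , u∈f , v∈f , f≢e ← avoiding-subset ∣S∣ 3≤r u∈ v∈ e
      = proj₁ (proj₂ (other f⊆S ∣f∣ f≢e)) u∈f v∈f u≢v

    rank≤ : ∀ s → e ≡ edge s → rank s ≤ suc t
    rank≤ s refl with v , v∈S , v∉e ← ∣p∣<∣q∣⇒q⊈p (subst₂ _<_ (sym ∣e∣) (sym ∣S∣) (ℕ.n<1+n r)) =
      ℕ.≤-trans (rigid move) (s≤s (proj₂ (proj₂ (other (edge-⊆ {s′} s′∈S) (∣edge∣ s′) s′≢e)) s′ refl))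
      where
      d : Fin r
      d = part v

      τ : Fin r → Fin n
      τ = updateAt (tuple s) d (const v)

      τ-parts : ∀ i → part (τ i) ≡ i
      τ-parts i with i ≟ d
      ... | yes refl = cong part (updateAt-updates d (tuple s))
      ... | no i≢d = trans (cong part (updateAt-minimal i d (tuple s) i≢d)) (tuple-part s i)

      τ∈S : ∀ i → τ i ∈ S
      τ∈S i with i ≟ d
      ... | yes refl = subst (_∈ S) (sym (updateAt-updates d (tuple s))) v∈S
      ... | no i≢d = subst (_∈ S) (sym (updateAt-minimal i d (tuple s) i≢d)) (e⊆S (∈-image⁺ (tuple s) i))

      found : ∃ λ s′ → ∀ i → τ i ≡ tuple s′ i
      found = complete (transversal-∈ τ-parts τ∈S clS)

      s′ : State
      s′ = proj₁ found

      s′∈S : ∀ i → tuple s′ i ∈ S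
      s′∈S i = subst (_∈ S) (proj₂ found i) (τ∈S i)

      s′d≡v : tuple s′ d ≡ v
      s′d≡v = trans (sym (proj₂ found d)) (updateAt-updates d (tuple s))

      s′≢e : edge s′ ≢ edge s
      s′≢e eq = v∉e (subst₂ _∈_ s′d≡v eq (∈-image⁺ (tuple s′) d))

      move : Move Adj (tuple s′) (tuple s)
      move = record
        { digit = d
        ; adjacent = subst (λ x → Adj x (tuple s d)) (sym s′d≡v)
            (clS v∈S (e⊆S (∈-image⁺ (tuple s) d)) λ { v≡ → v∉e (subst (_∈ edge s) (sym v≡) (∈-image⁺ (tuple s) d)) })
        ; same = λ {i} i≢d → trans (sym (proj₂ found i)) (updateAt-minimal i d (tuple s) i≢d) }

  -- Only a path edge of rank `suc t` is new. Adding to it the vertex that its predecessor has in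
  -- the moved digit gives an (r+1)-clique whose other r-subsets are infected: the only other path
  -- edge among them is the predecessor.
  grows : ∀ {t e} → Infected (suc t) e → step r (suc r) (Infected t) e
  grows {t} {e} (∣e∣ , cl , rk) with isEdge? cl ∣e∣
  ... | no ¬edge = inj₁ (∣e∣ , (λ {_} → cl) , λ s eq → contradiction (s , eq) ¬edge)
  ... | yes (s , refl) with rank s ℕ.≤? t
  ...   | yes ≤t = inj₁ (∣e∣ , (λ {_} → cl) , λ s″ eq → subst (λ x → rank x ≤ t) (edge-injective eq) ≤t)
  ...   | no ≰t with pred s
  ...     | inj₁ refl = contradiction (subst (_≤ t) (sym rank-first) z≤n) ≰t
  ...     | inj₂ (s′ , rank-s , move) = inj₂ (∣e∣ , S , ∣S∣ , ¬all , cov)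
    where
    open Move move renaming (digit to d)
    w : Fin n
    w = tuple s′ d

    S : Subset n
    S = ⁅ w ⁆ ∪ edge s

    e⊆S : edge s ⊆ S
    e⊆S = q⊆p∪q ⁅ w ⁆ (edge s)

    same-digit : ∀ {i} → w ≡ tuple s i → d ≡ i
    same-digit {i} w≡ = trans (sym (tuple-part s′ d)) (trans (cong part w≡) (tuple-part s i))

    w∉e : w ∉ edge s
    w∉e w∈ with i , w≡ ← ∈-image⁻ (tuple s) w∈ with refl ← same-digit w≡ =
      ℕ.1+n≢n (trans (sym rank-s) (cong rank (sym (tuple-injective eq))))
      where
      eq : ∀ i → tuple s′ i ≡ tuple s i
      eq i with i ≟ d
      ... | yes refl = w≡
      ... | no i≢d = same i≢d

    ∣S∣ : ∣ S ∣ ≡ suc r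
    ∣S∣ = trans (∣⁅x⁆∪p∣≡1+∣p∣ (edge s) w∉e) (cong suc ∣e∣)

    ¬all : ¬ (∀ f → CopyEdges r S f → Infected t f)
    ¬all all = ≰t (proj₂ (proj₂ (all (edge s) (e⊆S , ∣e∣))) s refl)

    w-adj : ∀ i → Adj w (tuple s i)
    w-adj i with d ≟ i
    ... | yes refl = adjacent
    ... | no d≢i = subst (Adj w) (same (≢-sym d≢i)) (tuple-adj s′ d≢i)

    S⁻ : ∀ {x} → x ∈ S → x ≡ w ⊎ ∃ λ i → x ≡ tuple s i
    S⁻ x∈ with x∈p∪q⁻ ⁅ w ⁆ (edge s) x∈
    ... | inj₁ x∈w = inj₁ (x∈⁅y⁆⇒x≡y w x∈w)
    ... | inj₂ x∈e = inj₂ (∈-image⁻ (tuple s) x∈e)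

    clS : Clique S
    clS u∈ v∈ u≢v with S⁻ u∈ | S⁻ v∈
    ... | inj₁ refl | inj₁ refl = contradiction refl u≢v
    ... | inj₁ refl | inj₂ (i , refl) = w-adj i
    ... | inj₂ (i , refl) | inj₁ refl = adj-sym (w-adj i)
    ... | inj₂ (i , refl) | inj₂ (j , refl) = tuple-adj s λ { refl → u≢v refl }

    -- `S` has a single vertex in every part but `d`, where it has two: that of `s` and that of
    -- `s′`.
    states-in-S : ∀ {s″} → (∀ i → tuple s″ i ∈ S) → s″ ≡ s ⊎ s″ ≡ s′
    states-in-S {s″} ∈S = decide (S⁻ (∈S d))
      where
      digit-of-s : ∀ {i j} → tuple s″ i ≡ tuple s j → tuple s″ i ≡ tuple s i
      digit-of-s {i} {j} eq = trans eq (cong (tuple s) (trans (sym (tuple-part s j)) (trans (cong part (sym eq)) (tuple-part s″ i))))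

      off-d : ∀ {i} → i ≢ d → tuple s″ i ≡ tuple s i
      off-d {i} i≢d with S⁻ (∈S i)
      ... | inj₁ eq = contradiction (trans (sym (tuple-part s″ i)) (trans (cong part eq) (tuple-part s′ d))) i≢d
      ... | inj₂ (j , eq) = digit-of-s eq

      decide : tuple s″ d ≡ w ⊎ (∃ λ i → tuple s″ d ≡ tuple s i) → s″ ≡ s ⊎ s″ ≡ s′
      decide (inj₁ eq) = inj₂ (tuple-injective all-eq)
        where
        all-eq : ∀ i → tuple s″ i ≡ tuple s′ i
        all-eq i with i ≟ d
        ... | yes refl = eq
        ... | no i≢d = trans (off-d i≢d) (sym (same i≢d))
      decide (inj₂ (j , eq)) = inj₁ (tuple-injective all-eq)
        where
        all-eq : ∀ i → tuple s″ i ≡ tuple s i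
        all-eq i with i ≟ d
        ... | yes refl = digit-of-s eq
        ... | no i≢d = off-d i≢d

    cov : ∀ f → CopyEdges r S f → Infected t f ⊎ f ≡ edge s
    cov f (f⊆S , ∣f∣) with ≡-dec _≟ᵇ_ f (edge s)
    ... | yes f≡e = inj₂ f≡e
    ... | no f≢e = inj₁ (∣f∣ , (λ {_} → clique-⊆ f⊆S clS) , rank≤t)
      where
      rank≤t : ∀ s″ → f ≡ edge s″ → rank s″ ≤ t
      rank≤t s″ refl with states-in-S {s″} (λ i → f⊆S (∈-image⁺ (tuple s″) i))
      ... | inj₁ refl = contradiction refl f≢e
      ... | inj₂ refl = s≤s⁻¹ (subst (_≤ suc t) rank-s (rk s refl))

  G₀ : Hypergraph n
  G₀ = Infected 0

  process≗Infected : ∀ t → SameEdges (process r (suc r) G₀ t) (Infected t)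
  process≗Infected zero e = (λ Ge → Ge) , λ Ge → Ge
  process≗Infected (suc t) e =
    (λ Ge → sound (step-cong (process≗Infected t) Ge)) ,
    (λ inf → step-cong (λ f → Product.swap (process≗Infected t f)) (grows inf))

  -- Walking back from `last` lowers the rank by one at a time, so no rank is skipped and each of
  -- the first `T` steps infects something.
  state-of-rank : ∀ j → j ≤ T → ∃ λ s → rank s ≡ j
  state-of-rank j j≤T = descend (T ∸ j) last (trans rank-last (sym (ℕ.m∸n+n≡m j≤T)))
    where
    descend : ∀ i s → rank s ≡ i + j → ∃ λ s′ → rank s′ ≡ j
    descend zero s eq = s , eq
    descend (suc i) s eq with pred s
    ... | inj₁ refl = contradiction (trans (sym rank-first) eq) λ ()
    ... | inj₂ (s′ , rank-s , _) = descend i s′ (ℕ.suc-injective (trans (sym rank-s) eq))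

  isRunningTime : IsRunningTime r (suc r) G₀ T
  isRunningTime = (λ e → inj₁ , stable e) , λ t t<T same →
    let s , rank-s = state-of-rank (suc t) t<T
        inf : Infected (suc t) (edge s)
        inf = ∣edge∣ s , (λ {_} → edge-clique s) , λ s′ eq → subst (λ x → rank x ≤ suc t) (edge-injective eq) (ℕ.≤-reflexive rank-s)
        old = proj₁ (process≗Infected t _) (proj₂ (same _) (proj₂ (process≗Infected (suc t) _) inf))
    in ℕ.<⇒≱ (ℕ.≤-reflexive (sym rank-s)) (proj₂ (proj₂ old) s refl)
    where
    stable : ∀ e → process r (suc r) G₀ (suc T) e → process r (suc r) G₀ T e
    stable e Ge with ∣e∣ , cl , _ ← proj₁ (process≗Infected (suc T) e) Ge =
      proj₂ (process≗Infected T e) (∣e∣ , (λ {_} → cl) , λ s _ → rank≤T s)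

-- Lengthening the path by one digit

Consecutive : Fin m → Fin m → Set
Consecutive i j = toℕ j ≡ suc (toℕ i) ⊎ toℕ i ≡ suc (toℕ j)

-- Base of the induction: with one part, the transversal cliques are the vertices of an ordinary
-- path.
singletons : ∀ m → CliquePath 1 m (Fin (suc m))
singletons m = record
  { part = λ _ → zero
  ; Adj = Consecutive
  ; adj-sym = swap
  ; State = Fin (suc m)
  ; tuple = λ s _ → s
  ; rank = toℕ
  ; first = zero
  ; last = fromℕ m
  ; rank-first = refl
  ; rank-last = Fin.toℕ-fromℕ m
  ; rank≤T = Fin.toℕ≤pred[n]
  ; transversal = λ s → record
    { parts = λ { zero → refl }
    ; adjacent = λ { {zero} {zero} 0≢0 → contradiction refl 0≢0 } }
  ; tuple-injective = λ eq → eq zero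
  ; complete = λ {τ} _ → τ zero , λ { zero → refl }
  ; rigid = λ mv → consecutive-≤ (Move.adjacent mv)
  ; pred = λ
    { zero → inj₁ refl
    ; (suc s) → inj₂ (inject₁ s , cong suc (sym (Fin.toℕ-inject₁ s)) , record
      { digit = zero
      ; adjacent = inj₁ (cong suc (sym (Fin.toℕ-inject₁ s)))
      ; same = λ { {zero} 0≢0 → contradiction refl 0≢0 } }) }
  }
  where
  consecutive-≤ : {i j : Fin (suc m)} → Consecutive i j → toℕ j ≤ suc (toℕ i)
  consecutive-≤ (inj₁ eq) = ℕ.≤-reflexive eq
  consecutive-≤ {i} {j} (inj₂ eq) = ℕ.m≤n⇒m≤1+n (ℕ.≤-trans (ℕ.n≤1+n (toℕ j)) (ℕ.≤-reflexive (sym eq)))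

nextCopy prevCopy : Fin 3 → Fin 3
nextCopy 0F = 1F
nextCopy 1F = 2F
nextCopy 2F = 0F
prevCopy 0F = 2F
prevCopy 1F = 0F
prevCopy 2F = 1F

prev-next : ∀ κ → prevCopy (nextCopy κ) ≡ κ
prev-next 0F = refl
prev-next 1F = refl
prev-next 2F = refl

prev≢ : ∀ κ → prevCopy κ ≢ κ
prev≢ 0F ()
prev≢ 1F ()
prev≢ 2F ()

-- The reason for three copies: with two, the preceding copy would also be the following one, and
-- cross edges would lose their direction.
prev²≢ : ∀ κ → prevCopy (prevCopy κ) ≢ κ
prev²≢ 0F ()
prev²≢ 1F ()
prev²≢ 2F ()

copyOf : ℕ → Fin 3
copyOf zero = 0F
copyOf (suc k) = nextCopy (copyOf k)

module Extend {q T : ℕ} {V : Set} (P : CliquePath (suc q) T V) (K₀ : ℕ) where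
  open CliquePath P

  -- A block belongs to one `x_k` and has `B` ranks: `R` for the junction states, then `suc T` for
  -- the walk through the copy. `T′` is the last rank of block `K₀`.
  R K B T′ : ℕ
  R = suc q
  K = suc K₀
  B = R + suc T
  T′ = K₀ * B + (R + T)

  Vertex : Set
  Vertex = Fin K ⊎ (Fin 3 × V)

  Offset : Set
  Offset = Fin R ⊎ State

  -- A new digit j coexists with an old digit i only if j ≤ i, so in a mixed clique the new digits
  -- precede the old ones. Equality is allowed for the exchange of a digit itself.
  Cross : Fin 3 × V → Fin 3 × V → Set
  Cross (κ , u) (κ′ , v) =
    κ ≡ prevCopy κ′ × u ≡ tuple last (part u) × v ≡ tuple first (part v) × part v Fin.≤ part u

  Layer : Fin 3 × V → Fin 3 × V → Set
  Layer x@(κ , u) y@(κ′ , v) = (κ ≡ κ′ × Adj u v) ⊎ (Cross x y ⊎ Cross y x)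

  layer-sym : ∀ x y → Layer x y → Layer y x
  layer-sym x y (inj₁ (κ≡ , adj)) = inj₁ (sym κ≡ , adj-sym adj)
  layer-sym x y (inj₂ cr) = inj₂ (swap cr)

  Spoke : Fin 3 → Fin 3 × V → Set
  Spoke c (κ , v) = κ ≡ c ⊎ (κ ≡ prevCopy c × v ≡ tuple last (part v))

  copy : Fin K → Fin 3
  copy k = copyOf (toℕ k)

  Adj′ : Vertex → Vertex → Set
  Adj′ (inj₁ k) (inj₁ k′) = Consecutive k k′
  Adj′ (inj₁ k) (inj₂ x) = Spoke (copy k) x
  Adj′ (inj₂ x) (inj₁ k) = Spoke (copy k) x
  Adj′ (inj₂ x) (inj₂ y) = Layer x y

  adj′-sym : ∀ {x y} → Adj′ x y → Adj′ y x
  adj′-sym {inj₁ k} {inj₁ k′} = swap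
  adj′-sym {inj₁ k} {inj₂ x} sp = sp
  adj′-sym {inj₂ x} {inj₁ k} sp = sp
  adj′-sym {inj₂ x} {inj₂ y} = layer-sym x y

  part′ : Vertex → Fin (suc R)
  part′ (inj₁ k) = zero
  part′ (inj₂ (κ , v)) = suc (part v)

  -- Digit 0 is the slowest; in the d-th junction state the digits before d have already moved to copy c.
  junction : Fin 3 → Fin R → Fin R → Fin 3 × V
  junction c d i with i <? d
  ... | yes _ = c , tuple first i
  ... | no _ = prevCopy c , tuple last i

  junction-new : ∀ c {d i} → i Fin.< d → junction c d i ≡ (c , tuple first i)
  junction-new c {d} {i} i<d with i <? d
  ... | yes _ = refl
  ... | no i≮d = contradiction i<d i≮d

  junction-old : ∀ c {d i} → ¬ (i Fin.< d) → junction c d i ≡ (prevCopy c , tuple last i)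
  junction-old c {d} {i} i≮d with i <? d
  ... | yes i<d = contradiction i<d i≮d
  ... | no _ = refl

  tail : Fin 3 → Offset → Fin R → Fin 3 × V
  tail c (inj₁ d) = junction c d
  tail c (inj₂ s) i = c , tuple s i

  tuple′ : Fin K × Offset → Fin (suc R) → Vertex
  tuple′ (k , y) zero = inj₁ k
  tuple′ (k , y) (suc i) = inj₂ (tail (copy k) y i)

  offset : Offset → ℕ
  offset (inj₁ d) = toℕ d
  offset (inj₂ s) = R + rank s

  offset≤ : ∀ y → offset y ≤ R + T
  offset≤ (inj₁ d) = ℕ.≤-trans (ℕ.<⇒≤ (Fin.toℕ<n d)) (ℕ.m≤m+n R T)
  offset≤ (inj₂ s) = ℕ.+-monoʳ-≤ R (rank≤T s)

  rank′ : Fin K × Offset → ℕ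
  rank′ (k , y) = toℕ k * B + offset y

  tail-part : ∀ c y i → part (proj₂ (tail c y i)) ≡ i
  tail-part c (inj₁ d) i with i <? d
  ... | yes _ = tuple-part first i
  ... | no _ = tuple-part last i
  tail-part c (inj₂ s) i = tuple-part s i

  tail-spoke : ∀ c y i → Spoke c (tail c y i)
  tail-spoke c (inj₁ d) i with i <? d
  ... | yes _ = inj₁ refl
  ... | no _ = inj₂ (refl , cong (tuple last) (sym (tuple-part last i)))
  tail-spoke c (inj₂ s) i = inj₁ refl

  cross : ∀ c {i j} → j Fin.≤ i → Cross (prevCopy c , tuple last i) (c , tuple first j)
  cross c {i} {j} j≤i = refl , cong (tuple last) (sym (tuple-part last i)) , cong (tuple first) (sym (tuple-part first j)) ,
    subst₂ Fin._≤_ (sym (tuple-part first j)) (sym (tuple-part last i)) j≤i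

  tail-layer : ∀ c y {i j} → i ≢ j → Layer (tail c y i) (tail c y j)
  tail-layer c (inj₁ d) {i} {j} i≢j with i <? d | j <? d
  ... | yes _ | yes _ = inj₁ (refl , tuple-adj first i≢j)
  ... | no _ | no _ = inj₁ (refl , tuple-adj last i≢j)
  ... | yes i<d | no j≮d = inj₂ (inj₂ (cross c (ℕ.<⇒≤ (ℕ.<-≤-trans i<d (ℕ.≮⇒≥ j≮d)))))
  ... | no i≮d | yes j<d = inj₂ (inj₁ (cross c (ℕ.<⇒≤ (ℕ.<-≤-trans j<d (ℕ.≮⇒≥ i≮d)))))
  tail-layer c (inj₂ s) i≢j = inj₁ (refl , tuple-adj s i≢j)

  transversal′ : ∀ s → IsTransversal part′ Adj′ (tuple′ s)
  transversal′ (k , y) = record { parts = parts ; adjacent = adjacent }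
    where
    parts : ∀ i → part′ (tuple′ (k , y) i) ≡ i
    parts zero = refl
    parts (suc i) = cong suc (tail-part (copy k) y i)
    adjacent : ∀ {i j} → i ≢ j → Adj′ (tuple′ (k , y) i) (tuple′ (k , y) j)
    adjacent {zero} {zero} 0≢0 = contradiction refl 0≢0
    adjacent {zero} {suc j} _ = tail-spoke (copy k) y j
    adjacent {suc i} {zero} _ = tail-spoke (copy k) y i
    adjacent {suc i} {suc j} i≢j = tail-layer (copy k) y (i≢j ∘ cong suc)

  old≢new : ∀ c {d i} → ¬ (i Fin.< d) → proj₁ (junction c d i) ≢ c
  old≢new c i≮d eq = prev≢ c (trans (sym (cong proj₁ (junction-old c i≮d))) eq)

  -- The copies that occur reveal the offset: `d` is the first digit still in the preceding copy,
  -- and inside a copy there is none.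
  tail-injective : ∀ c {y y′} → (∀ i → tail c y i ≡ tail c y′ i) → y ≡ y′
  tail-injective c {inj₁ d} {inj₁ d′} eq with Fin.<-cmp d d′
  ... | tri≈ _ d≡d′ _ = cong inj₁ d≡d′
  ... | tri< d<d′ _ _ = contradiction (trans (cong proj₁ (eq d)) (cong proj₁ (junction-new c d<d′))) (old≢new c {d} (ℕ.<-irrefl refl))
  ... | tri> _ _ d>d′ = contradiction (trans (cong proj₁ (sym (eq d′))) (cong proj₁ (junction-new c d>d′))) (old≢new c {d′} (ℕ.<-irrefl refl))
  tail-injective c {inj₁ d} {inj₂ s} eq = contradiction (cong proj₁ (eq d)) (old≢new c {d} (ℕ.<-irrefl refl))
  tail-injective c {inj₂ s} {inj₁ d} eq = contradiction (cong proj₁ (sym (eq d))) (old≢new c {d} (ℕ.<-irrefl refl))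
  tail-injective c {inj₂ s} {inj₂ s′} eq = cong inj₂ (tuple-injective (cong proj₂ ∘ eq))

  tuple′-injective : ∀ {s s′} → (∀ i → tuple′ s i ≡ tuple′ s′ i) → s ≡ s′
  tuple′-injective {k , y} {k′ , y′} eq with refl ← inj₁-injective (eq zero) =
    cong (k ,_) (tail-injective (copy k) (inj₂-injective ∘ eq ∘ suc))

  same-copy : ∀ {κ κ′ u v} → κ ≡ κ′ → Layer (κ , u) (κ′ , v) → Adj u v
  same-copy refl (inj₁ (_ , adj)) = adj
  same-copy {κ} refl (inj₂ (inj₁ (eq , _))) = contradiction (sym eq) (prev≢ κ)
  same-copy {κ} refl (inj₂ (inj₂ (eq , _))) = contradiction (sym eq) (prev≢ κ)

  next-copy : ∀ {κ κ′ u v} → κ ≡ prevCopy κ′ → Layer (κ , u) (κ′ , v) → Cross (κ , u) (κ′ , v)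
  next-copy {κ′ = κ′} κ≡ (inj₁ (κ≡κ′ , _)) = contradiction (trans (sym κ≡) κ≡κ′) (prev≢ κ′)
  next-copy κ≡ (inj₂ (inj₁ cr)) = cr
  next-copy {κ′ = κ′} refl (inj₂ (inj₂ (eq , _))) = contradiction (sym eq) (prev²≢ κ′)

  -- If all digits lie in copy `c`, completeness of `P` applies. Otherwise let `d` be the first old
  -- digit: the digits before it are new and, being crossed with it, belong to `first`; a new digit
  -- after it would violate the order in `Cross`.
  tail-complete : ∀ c (w : Fin R → Fin 3 × V) → (∀ i → part (proj₂ (w i)) ≡ i) → (∀ i → Spoke c (w i)) →
    (∀ {i j} → i ≢ j → Layer (w i) (w j)) → ∃ λ y → ∀ i → w i ≡ tail c y i
  tail-complete c w w-part w-spoke w-layer with Fin.all? (λ i → proj₁ (w i) ≟ c)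
  ... | yes all-c =
    let s , eq = complete (record
          { parts = w-part
          ; adjacent = λ {i} {j} i≢j → same-copy (trans (all-c i) (sym (all-c j))) (w-layer i≢j) })
    in inj₂ s , λ i → cong₂ _,_ (all-c i) (eq i)
  ... | no ¬all-c
    with d , κd≢c , below ← Fin.¬∀⟶∃¬-smallest R (λ i → proj₁ (w i) ≡ c) (λ i → proj₁ (w i) ≟ c) ¬all-c
    = inj₁ d , w≡junction
    where
    old : ∀ i → proj₁ (w i) ≢ c → w i ≡ (prevCopy c , tuple last i)
    old i κ≢c with w-spoke i
    ... | inj₁ κ≡c = contradiction κ≡c κ≢c
    ... | inj₂ (κ≡ , v≡) = cong₂ _,_ κ≡ (trans v≡ (cong (tuple last) (w-part i)))

    below-c : ∀ {i} → i Fin.< d → proj₁ (w i) ≡ c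
    below-c {i} i<d = subst (λ j → proj₁ (w j) ≡ c)
      (Fin.toℕ-injective (trans (Fin.toℕ-inject (fromℕ< i<d)) (Fin.toℕ-fromℕ< i<d))) (below (fromℕ< i<d))

    crossing : ∀ {i} → i ≢ d → proj₁ (w i) ≡ c → Cross (w d) (w i)
    crossing {i} i≢d κ≡c = next-copy (trans (cong proj₁ (old d κd≢c)) (cong prevCopy (sym κ≡c))) (w-layer (≢-sym i≢d))

    w≡junction : ∀ i → w i ≡ junction c d i
    w≡junction i with i <? d
    ... | yes i<d =
      let _ , _ , v≡ , _ = crossing (λ { refl → ℕ.<-irrefl refl i<d }) (below-c i<d)
      in cong₂ _,_ (below-c i<d) (trans v≡ (cong (tuple first) (w-part i)))
    ... | no i≮d = old i λ κ≡c →
      let i≢d = λ { refl → κd≢c κ≡c }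
          _ , _ , _ , i≤d = crossing i≢d κ≡c
      in i≢d (Fin.≤-antisym (subst₂ Fin._≤_ (w-part i) (w-part d) i≤d) (ℕ.≮⇒≥ i≮d))

  complete′ : ∀ {τ} → IsTransversal part′ Adj′ τ → ∃ λ s → ∀ i → τ i ≡ tuple′ s i
  complete′ {τ} tr with τ zero in τ₀≡ | IsTransversal.parts tr zero
  ... | inj₁ k | _ =
    let y , eq = tail-complete (copy k) w w-part w-spoke w-layer
    in (k , y) , λ { zero → τ₀≡ ; (suc i) → trans (w-eq i) (cong inj₂ (eq i)) }
    where
    open IsTransversal tr
    inner : ∀ x {i} → part′ x ≡ suc i → ∃ λ y → x ≡ inj₂ y × part (proj₂ y) ≡ i
    inner (inj₂ y) eq = y , refl , Fin.suc-injective eq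
    w : Fin R → Fin 3 × V
    w i = proj₁ (inner (τ (suc i)) (parts (suc i)))
    w-eq : ∀ i → τ (suc i) ≡ inj₂ (w i)
    w-eq i = proj₁ (proj₂ (inner (τ (suc i)) (parts (suc i))))
    w-part : ∀ i → part (proj₂ (w i)) ≡ i
    w-part i = proj₂ (proj₂ (inner (τ (suc i)) (parts (suc i))))
    w-spoke : ∀ i → Spoke (copy k) (w i)
    w-spoke i = subst₂ Adj′ τ₀≡ (w-eq i) (adjacent λ ())
    w-layer : ∀ {i j} → i ≢ j → Layer (w i) (w j)
    w-layer {i} {j} i≢j = subst₂ Adj′ (w-eq i) (w-eq j) (adjacent (i≢j ∘ Fin.suc-injective))

  -- Digit 0 of a tail for `c` lies in copy `c` or the one before, and neither of these is the copy
  -- after `c`.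
  shared-copy : ∀ {c c′ y y′} → prevCopy c′ ≡ c → (∀ i → tail c y i ≡ tail c′ y′ i) → proj₁ (tail c′ y′ zero) ≢ c′
  shared-copy {c} {c′} {y} refl eq new with tail-spoke c y zero
  ... | inj₁ κ≡c = prev≢ c′ (trans (sym κ≡c) (trans (cong proj₁ (eq zero)) new))
  ... | inj₂ (κ≡ , _) = prev²≢ c′ (trans (sym κ≡) (trans (cong proj₁ (eq zero)) new))

  -- Consecutive blocks share only the last clique of the earlier copy.
  shared-tail : ∀ {c c′ y y′} → prevCopy c′ ≡ c → (∀ i → tail c y i ≡ tail c′ y′ i) → y ≡ inj₂ last × y′ ≡ inj₁ zero
  shared-tail {y = y} {inj₂ s′} c≡ eq = contradiction refl (shared-copy {y = y} {y′ = inj₂ s′} c≡ eq)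
  shared-tail {y = y} {inj₁ (suc d)} c≡ eq = contradiction refl (shared-copy {y = y} {y′ = inj₁ (suc d)} c≡ eq)
  shared-tail {c} {c′} {inj₁ d} {inj₁ zero} refl eq =
    contradiction (trans (cong proj₁ (eq d)) (cong proj₁ (junction-old c′ {zero} {d} λ ()))) (old≢new c {d} (ℕ.<-irrefl refl))
  shared-tail {c} {c′} {inj₂ s} {inj₁ zero} refl eq =
    cong inj₂ (tuple-injective λ i → cong proj₂ (eq i)) , refl

  -- Limits a move to one crossing: a digit that is old before and new after can only be the digit
  -- of the move.
  moved : ∀ c {d y i j} → (∀ {j} → j ≢ i → junction c d j ≡ tail c y j) →
    ¬ (j Fin.< d) → proj₁ (tail c y j) ≡ c → j ≡ i
  moved c {i = i} {j} same j≮d κ≡c with j ≟ i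
  ... | yes j≡i = j≡i
  ... | no j≢i = contradiction (trans (cong proj₁ (same j≢i)) κ≡c) (old≢new c j≮d)

  -- Inside a copy this is `rigid` of `P`. Skipping a junction state would carry two digits across
  -- in one move. The copy can be entered only from the last junction state, and only at `first`.
  tail-rigid : ∀ c y y′ i → Layer (tail c y i) (tail c y′ i) → (∀ {j} → j ≢ i → tail c y j ≡ tail c y′ j) →
    offset y′ ≤ suc (offset y)
  tail-rigid c (inj₂ s) (inj₂ s′) i layer same = subst (R + rank s′ ≤_) (ℕ.+-suc R (rank s))
    (ℕ.+-monoʳ-≤ R (rigid (record { digit = i ; adjacent = same-copy refl layer ; same = cong proj₂ ∘ same })))
  tail-rigid c (inj₂ s) (inj₁ d′) i layer same =
    ℕ.m≤n⇒m≤1+n (ℕ.≤-trans (ℕ.<⇒≤ (Fin.toℕ<n d′)) (ℕ.m≤m+n R (rank s)))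
  tail-rigid c (inj₁ d) (inj₁ d′) i layer same with toℕ d′ ℕ.≤? suc (toℕ d)
  ... | yes d′≤1+d = d′≤1+d
  ... | no d′≰1+d = contradiction (trans (sym (Fin.toℕ-fromℕ< e<R)) (cong toℕ (trans e≡i (sym d≡i)))) ℕ.1+n≢n
    where
    1+d<d′ : suc (toℕ d) < toℕ d′
    1+d<d′ = ℕ.≰⇒> d′≰1+d
    e<R : suc (toℕ d) < R
    e<R = ℕ.<-trans 1+d<d′ (Fin.toℕ<n d′)
    d≡i : d ≡ i
    d≡i = moved c {d} {inj₁ d′} same (ℕ.<-irrefl refl) (cong proj₁ (junction-new c (ℕ.<-trans (ℕ.n<1+n _) 1+d<d′)))
    e≡i : fromℕ< e<R ≡ i
    e≡i = moved c {d} {inj₁ d′} same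
      (λ e<d → ℕ.<-asym (ℕ.n<1+n (toℕ d)) (subst (_< toℕ d) (Fin.toℕ-fromℕ< e<R) e<d))
      (cong proj₁ (junction-new c (subst (_< toℕ d′) (sym (Fin.toℕ-fromℕ< e<R)) 1+d<d′)))
  tail-rigid c (inj₁ d) (inj₂ s) i layer same
    with refl ← moved c {d} {inj₂ s} same (ℕ.<-irrefl refl) refl = begin
      R + rank s      ≡⟨ cong (λ x → R + rank x) s≡first ⟩
      R + rank first  ≡⟨ cong (R +_) rank-first ⟩
      R + 0           ≡⟨ ℕ.+-identityʳ R ⟩
      R               ≤⟨ ℕ.≮⇒≥ 1+d≮R ⟩
      suc (toℕ d)     ∎
    where
    open ℕ.≤-Reasoning
    1+d≮R : ¬ (suc (toℕ d) < R)
    1+d≮R e<R = ℕ.1+n≢n (trans (sym (Fin.toℕ-fromℕ< e<R)) (cong toℕ (moved c {d} {inj₂ s} {j = fromℕ< e<R} same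
      (λ e<d → ℕ.<-asym (ℕ.n<1+n (toℕ d)) (subst (_< toℕ d) (Fin.toℕ-fromℕ< e<R) e<d)) refl)))
    s≡first : s ≡ first
    s≡first = tuple-injective eq
      where
      eq : ∀ j → tuple s j ≡ tuple first j
      eq j with j ≟ d
      -- The exchanged digit arrives along a cross edge, whose new end belongs to `first`.
      ... | yes refl =
        let _ , _ , v≡ , _ = next-copy (cong proj₁ (junction-old c {d} (ℕ.<-irrefl refl))) layer
        in trans v≡ (cong (tuple first) (tuple-part s d))
      ... | no j≢d with j <? d
      ...   | yes j<d = cong proj₂ (trans (sym (same j≢d)) (junction-new c j<d))
      ...   | no j≮d = contradiction (moved c {d} {inj₂ s} same j≮d refl) j≢d

  B-step : ∀ k → suc k * B ≡ suc (k * B + (R + T))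
  B-step k = trans (ℕ.+-comm B (k * B)) (trans (cong (k * B +_) (ℕ.+-suc R T)) (ℕ.+-suc (k * B) (R + T)))

  block-boundary : ∀ {k k′ : Fin K} → toℕ k′ ≡ suc (toℕ k) → rank′ (k′ , inj₁ zero) ≡ suc (rank′ (k , inj₂ last))
  block-boundary {k} {k′} k′≡1+k = begin
    toℕ k′ * B + 0                       ≡⟨ ℕ.+-identityʳ _ ⟩
    toℕ k′ * B                           ≡⟨ cong (_* B) k′≡1+k ⟩
    suc (toℕ k) * B                      ≡⟨ B-step (toℕ k) ⟩
    suc (toℕ k * B + (R + T))            ≡⟨ cong (λ t → suc (toℕ k * B + (R + t))) rank-last ⟨
    suc (toℕ k * B + (R + rank last))    ∎
    where open ≡-Reasoning

  -- Advancing `x_k` fixes the tail, which must then be the one shared by the two blocks, so exactly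
  -- a block boundary is crossed. Going back lowers the rank, and any other move stays in its block.
  rigid′ : ∀ {s s′} → Move Adj′ (tuple′ s) (tuple′ s′) → rank′ s′ ≤ suc (rank′ s)
  rigid′ {k , y} {k′ , y′} record { digit = zero ; adjacent = inj₁ k′≡1+k ; same = same }
    with refl , refl ← shared-tail {y = y} {y′} (trans (cong (prevCopy ∘ copyOf) k′≡1+k) (prev-next (copy k)))
                                   (λ i → inj₂-injective (same {suc i} λ ()))
    = ℕ.≤-reflexive (block-boundary k′≡1+k)
  rigid′ {k , y} {k′ , y′} record { digit = zero ; adjacent = inj₂ k≡1+k′ } = begin
    toℕ k′ * B + offset y′     ≤⟨ ℕ.+-monoʳ-≤ (toℕ k′ * B) (offset≤ y′) ⟩
    toℕ k′ * B + (R + T)       ≤⟨ ℕ.n≤1+n _ ⟩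
    suc (toℕ k′ * B + (R + T)) ≡⟨ B-step (toℕ k′) ⟨
    suc (toℕ k′) * B           ≡⟨ cong (_* B) k≡1+k′ ⟨
    toℕ k * B                  ≤⟨ ℕ.m≤m+n (toℕ k * B) (offset y) ⟩
    toℕ k * B + offset y       ≤⟨ ℕ.n≤1+n _ ⟩
    suc (toℕ k * B + offset y) ∎
    where open ℕ.≤-Reasoning
  rigid′ {k , y} {k′ , y′} record { digit = suc i ; adjacent = layer ; same = same }
    with refl ← inj₁-injective (same {zero} λ ())
    = subst (rank′ (k , y′) ≤_) (ℕ.+-suc (toℕ k * B) (offset y)) (ℕ.+-monoʳ-≤ (toℕ k * B)
      (tail-rigid (copy k) y y′ i layer λ j≢i → inj₂-injective (same (j≢i ∘ Fin.suc-injective))))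

  tail-move : ∀ {k y y′} (i : Fin R) → offset y ≡ suc (offset y′) →
    Layer (tail (copy k) y′ i) (tail (copy k) y i) → (∀ {j} → j ≢ i → tail (copy k) y′ j ≡ tail (copy k) y j) →
    ∃ λ s′ → rank′ (k , y) ≡ suc (rank′ s′) × Move Adj′ (tuple′ s′) (tuple′ (k , y))
  tail-move {k} {y} {y′} i off layer same =
    (k , y′) , trans (cong (toℕ k * B +_) off) (ℕ.+-suc (toℕ k * B) (offset y′)) , record
      { digit = suc i
      ; adjacent = layer
      ; same = λ { {zero} _ → refl ; {suc j} sj≢si → cong inj₂ (same (sj≢si ∘ cong suc)) } }

  pred′ : ∀ s → s ≡ (zero , inj₁ zero) ⊎ ∃ λ s′ → rank′ s ≡ suc (rank′ s′) × Move Adj′ (tuple′ s′) (tuple′ s)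
  pred′ (zero , inj₁ zero) = inj₁ refl
  pred′ (suc k , inj₁ zero) = inj₂ ((inject₁ k , inj₂ last) , block-boundary {inject₁ k} {suc k} 1+k , record
    { digit = zero
    ; adjacent = inj₁ 1+k
    ; same = λ { {zero} 0≢0 → contradiction refl 0≢0 ; {suc i} _ → cong inj₂ (cong (_, tuple last i) copy≡) } })
    where
    1+k : suc (toℕ k) ≡ suc (toℕ (inject₁ k))
    1+k = cong suc (sym (Fin.toℕ-inject₁ k))
    copy≡ : copy (inject₁ k) ≡ prevCopy (copy (suc k))
    copy≡ = trans (cong copyOf (Fin.toℕ-inject₁ k)) (sym (prev-next (copyOf (toℕ k))))
  pred′ (k , inj₁ (suc d)) = inj₂ (tail-move {k} {inj₁ (suc d)} {inj₁ (inject₁ d)} (inject₁ d)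
    (cong suc (sym (Fin.toℕ-inject₁ d)))
    (subst₂ Layer (sym (junction-old c {inject₁ d} (ℕ.<-irrefl refl))) (sym (junction-new c d<1+d)) (inj₂ (inj₁ (cross c ℕ.≤-refl))))
    same)
    where
    c : Fin 3
    c = copy k
    d<1+d : inject₁ d Fin.< suc d
    d<1+d = s≤s (ℕ.≤-reflexive (Fin.toℕ-inject₁ d))
    same : ∀ {j} → j ≢ inject₁ d → junction c (inject₁ d) j ≡ junction c (suc d) j
    same {j} j≢d with j <? inject₁ d
    ... | yes j<d = sym (junction-new c (ℕ.<-trans j<d d<1+d))
    ... | no j≮d = sym (junction-old c λ j<1+d → j≮d (ℕ.≤∧≢⇒<
      (ℕ.≤-trans (s≤s⁻¹ j<1+d) (ℕ.≤-reflexive (sym (Fin.toℕ-inject₁ d)))) (j≢d ∘ Fin.toℕ-injective)))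
  pred′ (k , inj₂ s) with pred s
  ... | inj₂ (s′ , rank-s , mv) = inj₂ (tail-move {k} {inj₂ s} {inj₂ s′} (Move.digit mv)
    (trans (cong (R +_) rank-s) (ℕ.+-suc R (rank s′))) (inj₁ (refl , Move.adjacent mv)) (cong (copy k ,_) ∘ Move.same mv))
  -- The first clique of a copy comes from the last junction state, `fromℕ q`, where only the
  -- fastest digit is still old.
  ... | inj₁ refl = inj₂ (tail-move {k} {inj₂ first} {inj₁ (fromℕ q)} (fromℕ q)
    (trans (cong (R +_) rank-first) (trans (ℕ.+-identityʳ R) (cong suc (sym (Fin.toℕ-fromℕ q)))))
    (subst (λ x → Layer x (copy k , tuple first (fromℕ q))) (sym (junction-old (copy k) {fromℕ q} (ℕ.<-irrefl refl))) (inj₂ (inj₁ (cross (copy k) ℕ.≤-refl))))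
    λ {j} j≢q → junction-new (copy k) (ℕ.≤∧≢⇒< (Fin.≤fromℕ j) (j≢q ∘ Fin.toℕ-injective)))

  extend : CliquePath (suc R) T′ Vertex
  extend = record
    { part = part′
    ; Adj = Adj′
    ; adj-sym = λ {x} {y} → adj′-sym {x} {y}
    ; State = Fin K × Offset
    ; tuple = tuple′
    ; rank = rank′
    ; first = zero , inj₁ zero
    ; last = fromℕ K₀ , inj₂ last
    ; rank-first = refl
    ; rank-last = cong₂ (λ k t → k * B + (R + t)) (Fin.toℕ-fromℕ K₀) rank-last
    ; rank≤T = λ (k , y) → ℕ.+-mono-≤ (ℕ.*-monoˡ-≤ B (Fin.toℕ≤pred[n] k)) (offset≤ y)
    ; transversal = transversal′
    ; tuple-injective = tuple′-injective
    ; complete = complete′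
    ; rigid = λ {s} {s′} → rigid′ {s} {s′}
    ; pred = pred′
    }

-- Induction on r and the growth of the path length

LongPaths : ℕ → Set₁
LongPaths r = ∃ λ c → ∃ λ n₀ → 1 ≤ c × (∀ n → n₀ ≤ n → ∃ λ T → CliquePath r T (Fin n) × n ^ r ≤ c * T)

longPaths-1 : LongPaths 1
longPaths-1 = 2 , 2 , s≤s z≤n , λ { (suc (suc m)) (s≤s (s≤s _)) → suc m , singletons (suc m) , bound m }
  where
  bound : ∀ m → (2 + m) ^ 1 ≤ 2 * suc m
  bound m = subst (_≤ 2 * suc m) (sym (ℕ.^-identityʳ (2 + m))) (ℕ.+-mono-≤ (s≤s (z≤n {m})) (ℕ.m≤m+n (suc m) 0))

^-distribʳ-* : ∀ m n o → (m * n) ^ o ≡ m ^ o * n ^ o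
^-distribʳ-* m n zero = refl
^-distribʳ-* m n (suc o) = trans (cong (m * n *_) (^-distribʳ-* m n o))
  (ℕ.[m*n]*[o*p]≡[m*o]*[n*p] m n (m ^ o) (n ^ o))

-- Three copies on `n / 6` vertices each use at most half of the vertices, leaving at least n/2 for
-- the new part. With `n / 6` at least n/12, the bounds K ≥ n/2 and T′ ≥ K T give the constant.
longPaths-suc : ∀ q → LongPaths (suc q) → LongPaths (suc (suc q))
longPaths-suc q (c , n₀ , 1≤c , paths) = 2 * (12 ^ R * c) , suc n₀ * 6 , 1≤c′ , longer
  where
  R = suc q
  1≤c′ : 1 ≤ 2 * (12 ^ R * c)
  1≤c′ = ℕ.*-mono-≤ {1} {2} (s≤s z≤n) (ℕ.*-mono-≤ (ℕ.m^n>0 12 R) 1≤c)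

  longer : ∀ n → suc n₀ * 6 ≤ n → ∃ λ T → CliquePath (suc R) T (Fin n) × n ^ suc R ≤ 2 * (12 ^ R * c) * T
  longer n n-large = build (n ∸ 3 * n′) refl
    where
    n′ : ℕ
    n′ = n / 6

    -- The threshold makes `n′` large enough for `paths` and also positive, as `n≤12n′` requires.
    n₀<n′ : suc n₀ ≤ n′
    n₀<n′ = subst (_≤ n′) (m*n/n≡m (suc n₀) 6) (/-monoˡ-≤ 6 n-large)

    3n′+3n′≤n : 3 * n′ + 3 * n′ ≤ n
    3n′+3n′≤n = subst (_≤ n) (six n′) (m/n*n≤m n 6)
      where
      six : ∀ x → x * 6 ≡ 3 * x + 3 * x
      six = solve-∀

    3n′≤n : 3 * n′ ≤ n
    3n′≤n = ℕ.≤-trans (ℕ.m≤m+n (3 * n′) (3 * n′)) 3n′+3n′≤n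

    n≤12n′ : n ≤ 12 * n′
    n≤12n′ = begin
      n                  ≡⟨ m≡m%n+[m/n]*n n 6 ⟩
      n % 6 + n′ * 6     ≤⟨ ℕ.+-monoˡ-≤ (n′ * 6) (ℕ.<⇒≤ (m%n<n n 6)) ⟩
      6 + n′ * 6         ≤⟨ ℕ.+-monoˡ-≤ (n′ * 6) (ℕ.*-monoˡ-≤ 6 (ℕ.≤-trans (s≤s z≤n) n₀<n′)) ⟩
      n′ * 6 + n′ * 6    ≡⟨ twelve n′ ⟩
      12 * n′            ∎
      where
      open ℕ.≤-Reasoning
      twelve : ∀ x → x * 6 + x * 6 ≡ 12 * x
      twelve = solve-∀

    0<n : 0 < n
    0<n = ℕ.≤-trans (s≤s z≤n) n-large

    inner : ∃ λ T → CliquePath R T (Fin n′) × n′ ^ R ≤ c * T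
    inner = paths n′ (ℕ.<⇒≤ n₀<n′)

    T : ℕ
    T = proj₁ inner

    n≤2[n∸3n′] : n ≤ 2 * (n ∸ 3 * n′)
    n≤2[n∸3n′] = begin
      n                                     ≡⟨ ℕ.m+[n∸m]≡n 3n′≤n ⟨
      3 * n′ + (n ∸ 3 * n′)                 ≤⟨ ℕ.+-monoˡ-≤ (n ∸ 3 * n′) (ℕ.m+n≤o⇒m≤o∸n (3 * n′) 3n′+3n′≤n) ⟩
      (n ∸ 3 * n′) + (n ∸ 3 * n′)           ≡⟨ double (n ∸ 3 * n′) ⟩
      2 * (n ∸ 3 * n′)                      ∎
      where
      open ℕ.≤-Reasoning
      double : ∀ x → x + x ≡ 2 * x
      double = solve-∀

    build : ∀ K → n ∸ 3 * n′ ≡ K → ∃ λ T → CliquePath (suc R) T (Fin n) × n ^ suc R ≤ 2 * (12 ^ R * c) * T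
    -- An empty new part would force n ≤ 0.
    build zero K≡ with () ← ℕ.≤-trans 0<n (subst (λ K → n ≤ 2 * K) K≡ n≤2[n∸3n′])
    build (suc K₀) K≡ = T′ , relabel vertices extend , bound
      where
      open Extend (proj₁ (proj₂ inner)) K₀ using (extend; T′; Vertex)

      vertices : Vertex ↔ Fin n
      vertices = subst (λ N → Vertex ↔ Fin N) (trans (cong (_+ 3 * n′) (sym K≡)) (ℕ.m∸n+n≡m 3n′≤n))
        (↔-sym (↔-trans Fin.+↔⊎ (↔-refl ⊎-↔ Fin.*↔×)))

      KT≤T′ : suc K₀ * T ≤ T′
      KT≤T′ = subst (_≤ T′) (ℕ.+-comm (K₀ * T) T)
        (ℕ.+-mono-≤ (ℕ.*-monoʳ-≤ K₀ (ℕ.≤-trans (ℕ.n≤1+n T) (ℕ.m≤n+m (suc T) R))) (ℕ.m≤n+m T R))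

      open ℕ.≤-Reasoning
      arrange : ∀ K a c T → (2 * K) * (a * (c * T)) ≡ 2 * (a * c) * (K * T)
      arrange = solve-∀

      bound : n ^ suc R ≤ 2 * (12 ^ R * c) * T′
      bound = begin
        n * n ^ R                                ≤⟨ ℕ.*-mono-≤ (subst (λ K → n ≤ 2 * K) K≡ n≤2[n∸3n′]) (ℕ.^-monoˡ-≤ R n≤12n′) ⟩
        2 * suc K₀ * (12 * n′) ^ R               ≡⟨ cong (2 * suc K₀ *_) (^-distribʳ-* 12 n′ R) ⟩
        2 * suc K₀ * (12 ^ R * n′ ^ R)           ≤⟨ ℕ.*-monoʳ-≤ (2 * suc K₀) (ℕ.*-monoʳ-≤ (12 ^ R) (proj₂ (proj₂ inner))) ⟩
        2 * suc K₀ * (12 ^ R * (c * T))          ≡⟨ arrange (suc K₀) (12 ^ R) c T ⟩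
        2 * (12 ^ R * c) * (suc K₀ * T)          ≤⟨ ℕ.*-monoʳ-≤ (2 * (12 ^ R * c)) KT≤T′ ⟩
        2 * (12 ^ R * c) * T′                    ∎

longPaths : ∀ q → LongPaths (suc q)
longPaths zero = longPaths-1
longPaths (suc q) = longPaths-suc q (longPaths q)

theorem1p3 : ∀ (r : ℕ) → 3 ≤ r →
    ∃ λ (c : ℕ) → ∃ λ (C : ℕ) → ∃ λ (n₀ : ℕ) → 1 ≤ c × 1 ≤ C ×
    (∀ (n : ℕ) → n₀ ≤ n →
    (Σ (Hypergraph n) λ G₀ → Uniform r G₀ × ∃ λ t →
    IsRunningTime r (suc r) G₀ t × n ^ r ≤ c * t)
    × (∀ (G₀ : Hypergraph n) → Uniform r G₀ → ∀ t →
    IsRunningTime r (suc r) G₀ t → t ≤ C * n ^ r))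
theorem1p3 (suc q) 3≤r =
  let c , n₀ , 1≤c , paths = longPaths q in
  c , 1 , n₀ , 1≤c , s≤s z≤n , λ n n₀≤n →
    (let T , P , bound = paths n n₀≤n
         open Percolation 3≤r P
     in G₀ , (λ _ → proj₁) , T , isRunningTime , bound) ,
    λ G₀ unif t running → subst (t ≤_) (sym (ℕ.*-identityˡ _)) (runningTime≤nʳ G₀ unif t running)
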